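{- Let $p$ be an odd prime and let $x$ be an indeterminate. Then $$\sum_{k=0}^{p-1}\frac{\binom{2k}k^2}{16^k}\big(x^k-(-1)^{\frac{p-1}2}(1-x)^k\big)\equiv\sum_{k=0}^{\frac{p-1}2}\frac{\binom{2k}k^2}{16^k}\big(x^k-(-1)^{\frac{p-1}2}(1-x)^k\big)\equiv 0\pmod{p^2}.$$
   Context: The polynomials involved have rational coefficients whose denominators are prime to $p$; a congruence between such polynomials modulo $p^2$ means that every coefficient of their difference is a rational number whose numerator (in lowest terms) is divisible by $p^2$. -}

module Defs where

open import Algebra.Bundles.Raw using (RawRing)
import Algebra.Definitions.RawSemiring as RawSemiringDefs
open import Data.Integer.Base using (+_)
import Data.Integer.Divisibility as ℤ
open import Data.List.Base using (List; []; _∷_; map)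
open import Data.Nat.Base as ℕ using (ℕ; zero; suc)
open import Data.Nat.Combinatorics using (_C_)
open import Data.Nat.Properties using (m^n≢0)
open import Data.Rational.Base as ℚ using (ℚ; 0ℚ; 1ℚ; ↥_; _/_; +-*-rawRing)

-- Elements of ℚ[x] as coefficient lists, constant term first. Lists differing
-- only by trailing zeros denote the same polynomial; polynomials are compared
-- only through coeff.

Poly : Set
Poly = List ℚ

coeff : Poly → ℕ → ℚ
coeff []      _       = 0ℚ
coeff (a ∷ f) zero    = a
coeff (a ∷ f) (suc i) = coeff f i

0ₚ 1ₚ X : Poly
0ₚ = []
1ₚ = 1ℚ ∷ []
X  = 0ℚ ∷ 1ℚ ∷ []

infixl 6 _+ₚ_ _-ₚ_
infixl 7 _*ₚ_
infixr 7 _·_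
infixr 8 _^ₚ_

_+ₚ_ : Poly → Poly → Poly
[]      +ₚ g       = g
(a ∷ f) +ₚ []      = a ∷ f
(a ∷ f) +ₚ (b ∷ g) = (a ℚ.+ b) ∷ (f +ₚ g)

_·_ : ℚ → Poly → Poly
a · f = map (a ℚ.*_) f

_-ₚ_ : Poly → Poly → Poly
f -ₚ g = f +ₚ map ℚ.-_ g

_*ₚ_ : Poly → Poly → Poly
[]      *ₚ g = []
(a ∷ f) *ₚ g = (a · g) +ₚ (0ℚ ∷ (f *ₚ g))

_^ₚ_ : Poly → ℕ → Poly
f ^ₚ zero  = 1ₚ
f ^ₚ suc n = f *ₚ (f ^ₚ n)

-- The upper bound is included: ∑[k≤ n ] t = t 0 +ₚ … +ₚ t n.

∑[k≤_]_ : ℕ → (ℕ → Poly) → Poly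
∑[k≤ zero  ] t = t zero
∑[k≤ suc n ] t = (∑[k≤ n ] t) +ₚ t (suc n)

-- ↥ is the numerator in lowest terms. When m is a power of a prime p (other
-- than 1), m ∣ ↥ q already forces the denominator of q to be prime to p.

infix 4 _≡_[mod_]

_≡_[mod_] : Poly → Poly → ℕ → Set
f ≡ g [mod m ] = ∀ i → (+ m) ℤ.∣ (↥ coeff (f -ₚ g) i)

open RawSemiringDefs (RawRing.rawSemiring +-*-rawRing) public
  using () renaming (_^_ to _^ℚ_)

centralBinom²/16^ : ℕ → ℚ
centralBinom²/16^ k =
  _/_ (+ (((2 ℕ.* k) C k) ℕ.^ 2)) (16 ℕ.^ k) {{m^n≢0 16 k}}

{-# OPTIONS --safe #-}

-- Write p = 2n + 1 and l k = (-1)ᵏ C(n,k) C(n+k,k). The ratios of consecutive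
-- terms of 16ᵏ l k and of C(2k,k)² are 4((2k+1)² - p²)/(k+1)² and
-- 4(2k+1)²/(k+1)², so C(2k,k)²/16ᵏ ≡ l k (mod p²) for every k < p; beyond n both
-- sides vanish, so the two truncations agree. It remains to see that
-- ∑ l k xᵏ, the Legendre polynomial Pₙ(1 - 2x), is multiplied by (-1)ⁿ under
-- x ↦ 1 - x, which is the binomial identity ∑ l k C(k,i) = (-1)ⁿ C(n,i) C(n+i,i).

module Submission where

open import Defs
open import Data.Nat.Base using (ℕ; _∸_; _/_; _^_)
open import Data.Nat.Divisibility using (_∤_)
open import Data.Nat.Primality using (Prime)
open import Data.Product.Base using (_×_)
open import Data.Rational.Base using (-_; 1ℚ)

open import Data.Integer.Base as ℤ using (ℤ; +_; 0ℤ; 1ℤ; -1ℤ)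
import Data.Integer.Coprimality as ℤ
open import Data.Integer.Divisibility.Signed as ℤ using (divides)
import Data.Integer.Properties as ℤ
open import Data.Integer.Tactic.RingSolver using (solve-∀)
open import Data.List.Base using ([]; _∷_; map)
open import Data.Nat.Base as ℕ using (zero; suc; NonZero; _≤_; _<_; z<s; s<s; s≤s)
open import Data.Nat.Combinatorics
  using (_C_; nCk≡nC[n∸k]; nCn≡1; k>n⇒nCk≡0; nCk+nC[k+1]≡[n+1]C[k+1])
open import Data.Nat.Coprimality as Coprimality
  using (Coprime; coprime-divisor; prime⇒coprime; 1-coprimeTo)
open import Data.Nat.Divisibility as ℕ using (∣-trans; m%n≡0⇒n∣m)
open import Data.Nat.DivMod using (_%_; m%n<n; m≡m%n+[m/n]*n; m*n/n≡m)
open import Data.Nat.Primality using (prime[2]; prime⇒irreducible)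
import Data.Nat.Properties as ℕ
import Data.Nat.Tactic.RingSolver as ℕ-Solver
open import Data.Product.Base using (_,_)
open import Data.Rational.Base as ℚ using (ℚ; mkℚ; 0ℚ; toℚᵘ; ↥_)
import Data.Rational.Properties as ℚ
open import Data.Rational.Unnormalised.Base as ℚᵘ using (ℚᵘ; mkℚᵘ; *≡*; _≃_)
import Data.Rational.Unnormalised.Properties as ℚᵘ
open import Data.Sum.Base using (inj₁; inj₂)
open import Relation.Binary.PropositionalEquality
open import Relation.Nullary.Negation using (contradiction)

-- Coprimality

-- A common divisor of m and ab is coprime to a because it divides m, so it divides b.
coprime-* : ∀ {m a b} → Coprime m a → Coprime m b → Coprime m (a ℕ.* b)
coprime-* {a = a} m⊥a m⊥b {d} (d∣m , d∣ab) = m⊥b (d∣m , coprime-divisor d⊥a d∣ab)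
  where
  d⊥a : Coprime d a
  d⊥a (e∣d , e∣a) = m⊥a (∣-trans e∣d d∣m , e∣a)

coprime-^ : ∀ {m a} k → Coprime m a → Coprime m (a ^ k)
coprime-^ {m} zero    _   = Coprimality.sym (1-coprimeTo m)
coprime-^     (suc k) m⊥a = coprime-* m⊥a (coprime-^ k m⊥a)

odd⇒coprime-2 : ∀ {p} → 2 ∤ p → Coprime p 2
odd⇒coprime-2 2∤p (d∣p , d∣2) with prime⇒irreducible prime[2] d∣2
... | inj₁ d≡1  = d≡1
... | inj₂ refl = contradiction d∣p 2∤p

-- Division with remainder gives p = 1 + 2 (p / 2); substituting this into `(p ∸ 1) / 2` shows that
-- it equals p / 2.
odd⇒≡1+half*2 : ∀ {p} → 2 ∤ p → p ≡ suc ((p ∸ 1) / 2 ℕ.* 2)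
odd⇒≡1+half*2 {p} 2∤p =
  trans p≡ (cong (λ h → suc (h ℕ.* 2))
    (trans (sym (m*n/n≡m (p / 2) 2)) (cong (λ q → (q ∸ 1) / 2) (sym p≡))))
  where
  p≡ : p ≡ suc (p / 2 ℕ.* 2)
  p≡ with p % 2 in eq | m%n<n p 2 | m≡m%n+[m/n]*n p 2
  ... | 0 | _ | _      = contradiction (m%n≡0⇒n∣m p 2 eq) 2∤p
  ... | 1 | _ | p≡1+   = p≡1+
  ... | suc (suc _) | s≤s (s≤s ()) | _

-- Binomial coefficients

nC0≡1 : ∀ n → n C 0 ≡ 1
nC0≡1 n = trans (nCk≡nC[n∸k] {0} {n} ℕ.z≤n) (nCn≡1 n)

[m+n]Cm≡[m+n]Cn : ∀ m n → (m ℕ.+ n) C m ≡ (m ℕ.+ n) C n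
[m+n]Cm≡[m+n]Cn m n = trans (nCk≡nC[n∸k] (ℕ.m≤m+n m n))
                            (cong ((m ℕ.+ n) C_) (ℕ.m+n∸m≡n m n))

-- Induction on n. After Pascal's rule one copy of C(n+1,k+1) is set aside; the rest falls under the
-- hypothesis at k and at k + 1, and Pascal's rule recombines it.
[k+1]*[n+1]C[k+1]≡[n+1]*nCk : ∀ n k → suc k ℕ.* (suc n C suc k) ≡ suc n ℕ.* (n C k)
[k+1]*[n+1]C[k+1]≡[n+1]*nCk zero    zero    = refl
[k+1]*[n+1]C[k+1]≡[n+1]*nCk zero    (suc k)
  rewrite k>n⇒nCk≡0 {1} {suc (suc k)} (s<s z<s) = ℕ.*-zeroʳ k
[k+1]*[n+1]C[k+1]≡[n+1]*nCk (suc n) zero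
  rewrite sym (nCk+nC[k+1]≡[n+1]C[k+1] (suc n) 0) | nC0≡1 (suc n) =
  cong suc (trans ([k+1]*[n+1]C[k+1]≡[n+1]*nCk n zero) (cong (suc n ℕ.*_) (nC0≡1 n)))
[k+1]*[n+1]C[k+1]≡[n+1]*nCk (suc n) (suc k) = begin
  (2 ℕ.+ k) ℕ.* (suc (suc n) C suc (suc k))
    ≡⟨ cong ((2 ℕ.+ k) ℕ.*_) (nCk+nC[k+1]≡[n+1]C[k+1] (suc n) (suc k)) ⟨
  (2 ℕ.+ k) ℕ.* (b ℕ.+ c)
    ≡⟨ split k b c ⟩
  b ℕ.+ (suc k ℕ.* b ℕ.+ (2 ℕ.+ k) ℕ.* c)
    ≡⟨ cong (b ℕ.+_) (cong₂ ℕ._+_ ([k+1]*[n+1]C[k+1]≡[n+1]*nCk n k)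
                                  ([k+1]*[n+1]C[k+1]≡[n+1]*nCk n (suc k))) ⟩
  b ℕ.+ (suc n ℕ.* (n C k) ℕ.+ suc n ℕ.* (n C suc k))
    ≡⟨ cong (b ℕ.+_) (ℕ.*-distribˡ-+ (suc n) (n C k) (n C suc k)) ⟨
  b ℕ.+ suc n ℕ.* (n C k ℕ.+ n C suc k)
    ≡⟨ cong (λ z → b ℕ.+ suc n ℕ.* z) (nCk+nC[k+1]≡[n+1]C[k+1] n k) ⟩
  (2 ℕ.+ n) ℕ.* b
    ∎
  where
  open ≡-Reasoning
  b = suc n C suc k
  c = suc n C suc (suc k)
  split : ∀ k b c → (2 ℕ.+ k) ℕ.* (b ℕ.+ c) ≡ b ℕ.+ ((1 ℕ.+ k) ℕ.* b ℕ.+ (2 ℕ.+ k) ℕ.* c)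
  split = ℕ-Solver.solve-∀

centralBinom-suc : ∀ k → suc k ℕ.* ((2 ℕ.* suc k) C suc k) ≡
                         2 ℕ.* (1 ℕ.+ 2 ℕ.* k) ℕ.* ((2 ℕ.* k) C k)
-- Going from C(2k+2,k+1) down to C(2k,k) takes two absorptions, with the symmetry C(2k+1,k) =
-- C(2k+1,k+1) in between. The second one consumes a further factor k + 1, which is supplied here
-- and cancelled.
centralBinom-suc k = ℕ.*-cancelˡ-≡ _ _ (suc k) (begin
  suc k ℕ.* (suc k ℕ.* ((2 ℕ.* suc k) C suc k))
    ≡⟨ cong (λ z → suc k ℕ.* (suc k ℕ.* (z C suc k))) (ℕ.*-suc 2 k) ⟩
  suc k ℕ.* (suc k ℕ.* (suc (suc (2 ℕ.* k)) C suc k))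
    ≡⟨ cong (suc k ℕ.*_) ([k+1]*[n+1]C[k+1]≡[n+1]*nCk (suc (2 ℕ.* k)) k) ⟩
  suc k ℕ.* (suc (suc (2 ℕ.* k)) ℕ.* (suc (2 ℕ.* k) C k))
    ≡⟨ cong (λ z → suc k ℕ.* (suc (suc (2 ℕ.* k)) ℕ.* z)) middle ⟩
  suc k ℕ.* (suc (suc (2 ℕ.* k)) ℕ.* (suc (2 ℕ.* k) C suc k))
    ≡⟨ left k _ ⟩
  2 ℕ.* suc k ℕ.* (suc k ℕ.* (suc (2 ℕ.* k) C suc k))
    ≡⟨ cong (2 ℕ.* suc k ℕ.*_) ([k+1]*[n+1]C[k+1]≡[n+1]*nCk (2 ℕ.* k) k) ⟩
  2 ℕ.* suc k ℕ.* (suc (2 ℕ.* k) ℕ.* ((2 ℕ.* k) C k))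
    ≡⟨ right k _ ⟩
  suc k ℕ.* (2 ℕ.* (1 ℕ.+ 2 ℕ.* k) ℕ.* ((2 ℕ.* k) C k))
    ∎)
  where
  open ≡-Reasoning
  middle : suc (2 ℕ.* k) C k ≡ suc (2 ℕ.* k) C suc k
  middle = subst (λ z → z C k ≡ z C suc k)
    (trans (ℕ.+-suc k k) (cong (λ z → suc (k ℕ.+ z)) (sym (ℕ.+-identityʳ k))))
    ([m+n]Cm≡[m+n]Cn k (suc k))
  left : ∀ k z → (1 ℕ.+ k) ℕ.* ((2 ℕ.+ 2 ℕ.* k) ℕ.* z) ≡ 2 ℕ.* (1 ℕ.+ k) ℕ.* ((1 ℕ.+ k) ℕ.* z)
  left = ℕ-Solver.solve-∀
  right : ∀ k z → 2 ℕ.* (1 ℕ.+ k) ℕ.* ((1 ℕ.+ 2 ℕ.* k) ℕ.* z) ≡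
                  (1 ℕ.+ k) ℕ.* (2 ℕ.* (1 ℕ.+ 2 ℕ.* k) ℕ.* z)
  right = ℕ-Solver.solve-∀

infixl 6.5 _Cℤ_

-- Opaque because _C_ computes by a case distinction on k ≤ᵇ n, which would
-- otherwise be unfolded inside integer expressions.

opaque

  _Cℤ_ : ℕ → ℕ → ℤ
  n Cℤ k = + (n C k)

  nCℤ0≡1 : ∀ n → n Cℤ 0 ≡ 1ℤ
  nCℤ0≡1 n = cong +_ (nC0≡1 n)

  k>n⇒nCℤk≡0 : ∀ {n k} → n < k → n Cℤ k ≡ 0ℤ
  k>n⇒nCℤk≡0 n<k = cong +_ (k>n⇒nCk≡0 n<k)

  [m+n]Cℤm≡[m+n]Cℤn : ∀ m n → (m ℕ.+ n) Cℤ m ≡ (m ℕ.+ n) Cℤ n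
  [m+n]Cℤm≡[m+n]Cℤn m n = cong +_ ([m+n]Cm≡[m+n]Cn m n)

  pascal : ∀ n k → suc n Cℤ suc k ≡ n Cℤ k ℤ.+ n Cℤ suc k
  pascal n k = sym (cong +_ (nCk+nC[k+1]≡[n+1]C[k+1] n k))

  absorption : ∀ n k → + suc k ℤ.* (suc n Cℤ suc k) ≡ + suc n ℤ.* (n Cℤ k)
  absorption n k = trans (sym (ℤ.pos-* (suc k) _))
    (trans (cong +_ ([k+1]*[n+1]C[k+1]≡[n+1]*nCk n k)) (ℤ.pos-* (suc n) _))

-- Pascal's rule reduces this to `absorption`. Integer subtraction makes it valid beyond k = n too,
-- where the later induction over all k < p relies on it.
[k+1]*nC[k+1]≡[n-k]*nCk : ∀ n k →
  + suc k ℤ.* (n Cℤ suc k) ≡ (+ n ℤ.- + k) ℤ.* (n Cℤ k)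
[k+1]*nC[k+1]≡[n-k]*nCk n k = begin
  + suc k ℤ.* (n Cℤ suc k)
    ≡⟨ add-sub (+ k) (n Cℤ k) (n Cℤ suc k) ⟩
  + suc k ℤ.* (n Cℤ k ℤ.+ n Cℤ suc k) ℤ.- + suc k ℤ.* (n Cℤ k)
    ≡⟨ cong (λ z → + suc k ℤ.* z ℤ.- + suc k ℤ.* (n Cℤ k)) (pascal n k) ⟨
  + suc k ℤ.* (suc n Cℤ suc k) ℤ.- + suc k ℤ.* (n Cℤ k)
    ≡⟨ cong (ℤ._- + suc k ℤ.* (n Cℤ k)) (absorption n k) ⟩
  + suc n ℤ.* (n Cℤ k) ℤ.- + suc k ℤ.* (n Cℤ k)
    ≡⟨ collect (+ n) (+ k) (n Cℤ k) ⟩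
  (+ n ℤ.- + k) ℤ.* (n Cℤ k)
    ∎
  where
  open ≡-Reasoning
  add-sub : ∀ k b c → (1ℤ ℤ.+ k) ℤ.* c ≡ (1ℤ ℤ.+ k) ℤ.* (b ℤ.+ c) ℤ.- (1ℤ ℤ.+ k) ℤ.* b
  add-sub = solve-∀
  collect : ∀ n k b → (1ℤ ℤ.+ n) ℤ.* b ℤ.- (1ℤ ℤ.+ k) ℤ.* b ≡ (n ℤ.- k) ℤ.* b
  collect = solve-∀

-- Finite sums

sign : ℕ → ℤ
sign n = -1ℤ ℤ.^ n

sign²≡1 : ∀ n → sign n ℤ.* sign n ≡ 1ℤ
sign²≡1 zero    = refl
sign²≡1 (suc n) = trans (square (sign n)) (sign²≡1 n)
  where
  square : ∀ s → (-1ℤ ℤ.* s) ℤ.* (-1ℤ ℤ.* s) ≡ s ℤ.* s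
  square = solve-∀

sum : ℕ → (ℕ → ℤ) → ℤ
sum zero    f = f zero
sum (suc N) f = sum N f ℤ.+ f (suc N)

sum-cong : ∀ N {f g} → (∀ k → f k ≡ g k) → sum N f ≡ sum N g
sum-cong zero    f≗g = f≗g zero
sum-cong (suc N) f≗g = cong₂ ℤ._+_ (sum-cong N f≗g) (f≗g (suc N))

sum-linear : ∀ N a b f g →
  sum N (λ k → a ℤ.* f k ℤ.+ b ℤ.* g k) ≡ a ℤ.* sum N f ℤ.+ b ℤ.* sum N g
sum-linear zero    a b f g = refl
sum-linear (suc N) a b f g =
  trans (cong (ℤ._+ (a ℤ.* f (suc N) ℤ.+ b ℤ.* g (suc N))) (sum-linear N a b f g))
        (regroup a b (sum N f) (sum N g) (f (suc N)) (g (suc N)))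
  where
  regroup : ∀ a b s t x y → a ℤ.* s ℤ.+ b ℤ.* t ℤ.+ (a ℤ.* x ℤ.+ b ℤ.* y) ≡
                            a ℤ.* (s ℤ.+ x) ℤ.+ b ℤ.* (t ℤ.+ y)
  regroup = solve-∀

sum-head : ∀ N f → sum (suc N) f ≡ f zero ℤ.+ sum N (λ k → f (suc k))
sum-head zero    f = refl
sum-head (suc N) f = trans (cong (ℤ._+ f (suc (suc N))) (sum-head N f))
                           (ℤ.+-assoc (f zero) _ (f (suc (suc N))))

δ : ℕ → ℕ → ℤ
δ zero    zero    = 1ℤ
δ zero    (suc i) = 0ℤ
δ (suc k) zero    = 0ℤ
δ (suc k) (suc i) = δ k i

-- Because `f` vanishes beyond `N`, indices `i` outside the range of summation are covered as well.
sum-δ : ∀ N f → (∀ k → N < k → f k ≡ 0ℤ) → ∀ i → sum N (λ k → f k ℤ.* δ k i) ≡ f i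
sum-δ zero    f f≡0 zero    = ℤ.*-identityʳ (f 0)
sum-δ zero    f f≡0 (suc i) = trans (ℤ.*-zeroʳ (f 0)) (sym (f≡0 (suc i) z<s))
sum-δ (suc N) f f≡0 zero    = begin
  sum (suc N) (λ k → f k ℤ.* δ k 0)
    ≡⟨ sum-head N (λ k → f k ℤ.* δ k 0) ⟩
  f 0 ℤ.* 1ℤ ℤ.+ sum N (λ k → f (suc k) ℤ.* 0ℤ)
    ≡⟨ cong₂ ℤ._+_ (ℤ.*-identityʳ (f 0)) (zeros N) ⟩
  f 0 ℤ.+ 0ℤ
    ≡⟨ ℤ.+-identityʳ (f 0) ⟩
  f 0
    ∎
  where
  open ≡-Reasoning
  zeros : ∀ N → sum N (λ k → f (suc k) ℤ.* 0ℤ) ≡ 0ℤ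
  zeros zero    = ℤ.*-zeroʳ (f 1)
  zeros (suc N) = cong₂ ℤ._+_ (zeros N) (ℤ.*-zeroʳ (f (suc (suc N))))
sum-δ (suc N) f f≡0 (suc i) = begin
  sum (suc N) (λ k → f k ℤ.* δ k (suc i))
    ≡⟨ sum-head N (λ k → f k ℤ.* δ k (suc i)) ⟩
  f 0 ℤ.* 0ℤ ℤ.+ sum N (λ k → f (suc k) ℤ.* δ k i)
    ≡⟨ cong₂ ℤ._+_ (ℤ.*-zeroʳ (f 0))
                   (sum-δ N (λ k → f (suc k)) (λ k N<k → f≡0 (suc k) (s<s N<k)) i) ⟩
  0ℤ ℤ.+ f (suc i)
    ≡⟨ ℤ.+-identityˡ (f (suc i)) ⟩
  f (suc i)
    ∎
  where open ≡-Reasoning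

-- Alternating binomial sums

-- Summation by parts: Pascal's rule splits C(n+1,k) into C(n,k-1) + C(n,k), and shifting the first
-- half by one turns `g` into its difference. The last term is the one left unpaired at the upper
-- end.
sum-sign-pascal : ∀ n N (g : ℕ → ℤ) →
  sum (suc N) (λ k → sign k ℤ.* (suc n Cℤ k) ℤ.* g k) ≡
  sum N (λ k → sign k ℤ.* (n Cℤ k) ℤ.* (g k ℤ.- g (suc k)))
    ℤ.+ sign (suc N) ℤ.* (n Cℤ suc N) ℤ.* g (suc N)
sum-sign-pascal n zero g
  rewrite pascal n 0 | nCℤ0≡1 (suc n) | nCℤ0≡1 n = expand (n Cℤ 1) (g 0) (g 1)
  where
  expand : ∀ c x y → 1ℤ ℤ.* 1ℤ ℤ.* x ℤ.+ -1ℤ ℤ.* 1ℤ ℤ.* (1ℤ ℤ.+ c) ℤ.* y ≡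
           1ℤ ℤ.* 1ℤ ℤ.* (x ℤ.- y) ℤ.+ -1ℤ ℤ.* 1ℤ ℤ.* c ℤ.* y
  expand = solve-∀
sum-sign-pascal n (suc N) g
  rewrite sum-sign-pascal n N g | pascal n (suc N) =
  telescope (sum N λ k → sign k ℤ.* (n Cℤ k) ℤ.* (g k ℤ.- g (suc k)))
            (sign N) (n Cℤ suc N) (n Cℤ suc (suc N)) (g (suc N)) (g (suc (suc N)))
  where
  telescope : ∀ S s b c x y →
    S ℤ.+ -1ℤ ℤ.* s ℤ.* b ℤ.* x ℤ.+ -1ℤ ℤ.* (-1ℤ ℤ.* s) ℤ.* (b ℤ.+ c) ℤ.* y ≡
    S ℤ.+ -1ℤ ℤ.* s ℤ.* b ℤ.* (x ℤ.- y) ℤ.+ -1ℤ ℤ.* (-1ℤ ℤ.* s) ℤ.* c ℤ.* y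
  telescope = solve-∀

sum-sign-pascal-full : ∀ {n N} → n ≤ N → (g : ℕ → ℤ) →
  sum (suc N) (λ k → sign k ℤ.* (suc n Cℤ k) ℤ.* g k) ≡
  sum N (λ k → sign k ℤ.* (n Cℤ k) ℤ.* (g k ℤ.- g (suc k)))
sum-sign-pascal-full {n} {N} n≤N g = trans (sum-sign-pascal n N g)
  (trans (cong (λ z → S ℤ.+ sign (suc N) ℤ.* z ℤ.* g (suc N)) (k>n⇒nCℤk≡0 (s≤s n≤N)))
         (drop S (sign (suc N)) (g (suc N))))
  where
  S = sum N (λ k → sign k ℤ.* (n Cℤ k) ℤ.* (g k ℤ.- g (suc k)))
  drop : ∀ S s x → S ℤ.+ s ℤ.* 0ℤ ℤ.* x ≡ S
  drop = solve-∀

-- Induction on n: summation by parts lowers n and replaces the product of the other two binomials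
-- by its difference in k, which Pascal's rule expands into products of the same shape. The
-- parameters `M` and `r` are free because they grow in this expansion; M = n and r = 0 give the
-- identity for the Legendre coefficients.
sum-sign-binomials : ∀ n {N} → n ≤ N → ∀ i M r →
  sum N (λ k → sign k ℤ.* (n Cℤ k) ℤ.* ((k Cℤ i) ℤ.* ((M ℕ.+ k) Cℤ (n ℕ.+ r)))) ≡
  sign n ℤ.* ((n Cℤ i) ℤ.* ((M ℕ.+ i) Cℤ (i ℕ.+ r)))
sum-sign-binomials zero {N} _ i M r = trans (collapse N) (boundary i)
  where
  t : ℕ → ℤ
  t k = sign k ℤ.* (0 Cℤ k) ℤ.* ((k Cℤ i) ℤ.* ((M ℕ.+ k) Cℤ r))
  collapse : ∀ N → sum N t ≡ t 0
  collapse zero    = refl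
  collapse (suc N) rewrite k>n⇒nCℤk≡0 {0} {suc N} z<s =
    trans (cong₂ ℤ._+_ (collapse N) (vanish (sign (suc N)) _)) (ℤ.+-identityʳ (t 0))
    where
    vanish : ∀ s x → s ℤ.* 0ℤ ℤ.* x ≡ 0ℤ
    vanish = solve-∀
  boundary : ∀ i → 1ℤ ℤ.* (0 Cℤ 0) ℤ.* ((0 Cℤ i) ℤ.* ((M ℕ.+ 0) Cℤ r)) ≡
                   1ℤ ℤ.* ((0 Cℤ i) ℤ.* ((M ℕ.+ i) Cℤ (i ℕ.+ r)))
  boundary zero    rewrite nCℤ0≡1 0 = refl
  boundary (suc i) rewrite nCℤ0≡1 0 | k>n⇒nCℤk≡0 {0} {suc i} z<s = refl
sum-sign-binomials (suc n) {suc N} (s≤s n≤N) zero M r = begin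
  sum (suc N) (λ k → sign k ℤ.* (suc n Cℤ k) ℤ.* g k)
    ≡⟨ sum-sign-pascal-full n≤N g ⟩
  sum N (λ k → sign k ℤ.* (n Cℤ k) ℤ.* (g k ℤ.- g (suc k)))
    ≡⟨ sum-cong N step ⟩
  -- The summand with coefficient 0 is padding that lets the two-term `sum-linear` extract the sign.
  sum N (λ k → -1ℤ ℤ.* f k ℤ.+ 0ℤ ℤ.* f k)
    ≡⟨ sum-linear N -1ℤ 0ℤ f f ⟩
  -1ℤ ℤ.* sum N f ℤ.+ 0ℤ ℤ.* sum N f
    ≡⟨ cong (λ z → -1ℤ ℤ.* z ℤ.+ 0ℤ ℤ.* z) (sum-sign-binomials n n≤N 0 M r) ⟩
  -1ℤ ℤ.* (sign n ℤ.* ((n Cℤ 0) ℤ.* b)) ℤ.+ 0ℤ ℤ.* (sign n ℤ.* ((n Cℤ 0) ℤ.* b))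
    ≡⟨ cong (λ z → -1ℤ ℤ.* (sign n ℤ.* (z ℤ.* b)) ℤ.+ 0ℤ ℤ.* (sign n ℤ.* (z ℤ.* b)))
            (trans (nCℤ0≡1 n) (sym (nCℤ0≡1 (suc n)))) ⟩
  -1ℤ ℤ.* (sign n ℤ.* ((suc n Cℤ 0) ℤ.* b)) ℤ.+ 0ℤ ℤ.* (sign n ℤ.* ((suc n Cℤ 0) ℤ.* b))
    ≡⟨ clean (sign n) (suc n Cℤ 0) b ⟩
  sign (suc n) ℤ.* ((suc n Cℤ 0) ℤ.* b)
    ∎
  where
  open ≡-Reasoning
  f g : ℕ → ℤ
  f k = sign k ℤ.* (n Cℤ k) ℤ.* ((k Cℤ 0) ℤ.* ((M ℕ.+ k) Cℤ (n ℕ.+ r)))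
  g k = (k Cℤ 0) ℤ.* ((M ℕ.+ k) Cℤ (suc n ℕ.+ r))
  b = (M ℕ.+ 0) Cℤ r
  clean : ∀ s c b → -1ℤ ℤ.* (s ℤ.* (c ℤ.* b)) ℤ.+ 0ℤ ℤ.* (s ℤ.* (c ℤ.* b)) ≡
                    -1ℤ ℤ.* s ℤ.* (c ℤ.* b)
  clean = solve-∀
  difference : ∀ s c x y → s ℤ.* c ℤ.* (1ℤ ℤ.* y ℤ.- 1ℤ ℤ.* (x ℤ.+ y)) ≡
    -1ℤ ℤ.* (s ℤ.* c ℤ.* (1ℤ ℤ.* x)) ℤ.+ 0ℤ ℤ.* (s ℤ.* c ℤ.* (1ℤ ℤ.* x))
  difference = solve-∀
  step : ∀ k → sign k ℤ.* (n Cℤ k) ℤ.* (g k ℤ.- g (suc k)) ≡ -1ℤ ℤ.* f k ℤ.+ 0ℤ ℤ.* f k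
  step k rewrite nCℤ0≡1 k | nCℤ0≡1 (suc k) | ℕ.+-suc M k | pascal (M ℕ.+ k) (n ℕ.+ r) =
    difference (sign k) (n Cℤ k) ((M ℕ.+ k) Cℤ (n ℕ.+ r)) ((M ℕ.+ k) Cℤ (suc n ℕ.+ r))
sum-sign-binomials (suc n) {suc N} (s≤s n≤N) (suc i) M r = begin
  sum (suc N) (λ k → sign k ℤ.* (suc n Cℤ k) ℤ.* g k)
    ≡⟨ sum-sign-pascal-full n≤N g ⟩
  sum N (λ k → sign k ℤ.* (n Cℤ k) ℤ.* (g k ℤ.- g (suc k)))
    ≡⟨ sum-cong N step ⟩
  -- Both binomials in `g` change with k, so the difference has two parts: `f` is the instance (i +
  -- 1, M, r) of the claim for n, and `h` is the instance (i, M + 1, r + 1).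
  sum N (λ k → -1ℤ ℤ.* f k ℤ.+ -1ℤ ℤ.* h k)
    ≡⟨ sum-linear N -1ℤ -1ℤ f h ⟩
  -1ℤ ℤ.* sum N f ℤ.+ -1ℤ ℤ.* sum N h
    ≡⟨ cong₂ (λ y z → -1ℤ ℤ.* y ℤ.+ -1ℤ ℤ.* z)
             (sum-sign-binomials n n≤N (suc i) M r)
             (sum-sign-binomials n n≤N i (suc M) (suc r)) ⟩
  -1ℤ ℤ.* (sign n ℤ.* ((n Cℤ suc i) ℤ.* b)) ℤ.+
  -1ℤ ℤ.* (sign n ℤ.* ((n Cℤ i) ℤ.* ((suc M ℕ.+ i) Cℤ (i ℕ.+ suc r))))
    ≡⟨ cong (λ z → -1ℤ ℤ.* (sign n ℤ.* ((n Cℤ suc i) ℤ.* b)) ℤ.+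
                   -1ℤ ℤ.* (sign n ℤ.* ((n Cℤ i) ℤ.* z)))
            (cong₂ _Cℤ_ (sym (ℕ.+-suc M i)) (ℕ.+-suc i r)) ⟩
  -1ℤ ℤ.* (sign n ℤ.* ((n Cℤ suc i) ℤ.* b)) ℤ.+ -1ℤ ℤ.* (sign n ℤ.* ((n Cℤ i) ℤ.* b))
    ≡⟨ collect (sign n) (n Cℤ i) (n Cℤ suc i) b ⟩
  sign (suc n) ℤ.* ((n Cℤ i ℤ.+ n Cℤ suc i) ℤ.* b)
    ≡⟨ cong (λ z → sign (suc n) ℤ.* (z ℤ.* b)) (pascal n i) ⟨
  sign (suc n) ℤ.* ((suc n Cℤ suc i) ℤ.* b)
    ∎
  where
  open ≡-Reasoning
  f g h : ℕ → ℤ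
  f k = sign k ℤ.* (n Cℤ k) ℤ.* ((k Cℤ suc i) ℤ.* ((M ℕ.+ k) Cℤ (n ℕ.+ r)))
  g k = (k Cℤ suc i) ℤ.* ((M ℕ.+ k) Cℤ (suc n ℕ.+ r))
  h k = sign k ℤ.* (n Cℤ k) ℤ.* ((k Cℤ i) ℤ.* ((suc M ℕ.+ k) Cℤ (n ℕ.+ suc r)))
  b = (M ℕ.+ suc i) Cℤ (suc i ℕ.+ r)
  collect : ∀ s c d b → -1ℤ ℤ.* (s ℤ.* (d ℤ.* b)) ℤ.+ -1ℤ ℤ.* (s ℤ.* (c ℤ.* b)) ≡
                        -1ℤ ℤ.* s ℤ.* ((c ℤ.+ d) ℤ.* b)
  collect = solve-∀
  difference : ∀ s c u v x y →
    s ℤ.* c ℤ.* (v ℤ.* y ℤ.- (u ℤ.+ v) ℤ.* (x ℤ.+ y)) ≡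
    -1ℤ ℤ.* (s ℤ.* c ℤ.* (v ℤ.* x)) ℤ.+ -1ℤ ℤ.* (s ℤ.* c ℤ.* (u ℤ.* (x ℤ.+ y)))
  difference = solve-∀
  step : ∀ k → sign k ℤ.* (n Cℤ k) ℤ.* (g k ℤ.- g (suc k)) ≡ -1ℤ ℤ.* f k ℤ.+ -1ℤ ℤ.* h k
  step k rewrite pascal k i | ℕ.+-suc M k | ℕ.+-suc n r | pascal (M ℕ.+ k) (n ℕ.+ r) =
    difference (sign k) (n Cℤ k) (k Cℤ i) (k Cℤ suc i)
               ((M ℕ.+ k) Cℤ (n ℕ.+ r)) ((M ℕ.+ k) Cℤ (suc n ℕ.+ r))

-- Shifted Legendre polynomials

legendre : ℕ → ℕ → ℤ
legendre n k = sign k ℤ.* ((n Cℤ k) ℤ.* ((n ℕ.+ k) Cℤ k))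

-- The coefficient of xⁱ in xᵏ - (-1)ⁿ (1 - x)ᵏ.

reflectionCoeff : ℕ → ℕ → ℕ → ℤ
reflectionCoeff n k i = δ k i ℤ.- sign n ℤ.* (sign i ℤ.* (k Cℤ i))

-- The δ part sums to `legendre n i`; by `sum-sign-binomials` the other part gives the same value
-- times (-1)ⁿ (-1)ⁿ = 1, and the two cancel exactly. Any upper limit from n on is allowed, so both
-- truncations are covered.
legendre-reflection : ∀ {n N} → n ≤ N → ∀ i →
  sum N (λ k → legendre n k ℤ.* reflectionCoeff n k i) ≡ 0ℤ
legendre-reflection {n} {N} n≤N i = begin
  sum N (λ k → legendre n k ℤ.* reflectionCoeff n k i)
    ≡⟨ sum-cong N step ⟩
  sum N (λ k → 1ℤ ℤ.* (legendre n k ℤ.* δ k i) ℤ.+ c ℤ.* f k)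
    ≡⟨ sum-linear N 1ℤ c (λ k → legendre n k ℤ.* δ k i) f ⟩
  1ℤ ℤ.* sum N (λ k → legendre n k ℤ.* δ k i) ℤ.+ c ℤ.* sum N f
    ≡⟨ cong₂ (λ y z → 1ℤ ℤ.* y ℤ.+ c ℤ.* z) (sum-δ N (legendre n) vanish i)
             (sum-sign-binomials n n≤N i n 0) ⟩
  1ℤ ℤ.* legendre n i ℤ.+ c ℤ.* (sign n ℤ.* ((n Cℤ i) ℤ.* ((n ℕ.+ i) Cℤ (i ℕ.+ 0))))
    ≡⟨ cong (λ z → 1ℤ ℤ.* legendre n i ℤ.+ c ℤ.* (sign n ℤ.* ((n Cℤ i) ℤ.* ((n ℕ.+ i) Cℤ z))))
            (ℕ.+-identityʳ i) ⟩
  1ℤ ℤ.* legendre n i ℤ.+ c ℤ.* (sign n ℤ.* ((n Cℤ i) ℤ.* ((n ℕ.+ i) Cℤ i)))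
    ≡⟨ factor (sign n) (sign i) ((n Cℤ i) ℤ.* ((n ℕ.+ i) Cℤ i)) ⟩
  (1ℤ ℤ.- sign n ℤ.* sign n) ℤ.* legendre n i
    ≡⟨ cong (λ z → (1ℤ ℤ.- z) ℤ.* legendre n i) (sign²≡1 n) ⟩
  0ℤ ℤ.* legendre n i
    ≡⟨ ℤ.*-zeroˡ (legendre n i) ⟩
  0ℤ
    ∎
  where
  open ≡-Reasoning
  c = ℤ.- (sign n ℤ.* sign i)
  f : ℕ → ℤ
  f k = sign k ℤ.* (n Cℤ k) ℤ.* ((k Cℤ i) ℤ.* ((n ℕ.+ k) Cℤ (n ℕ.+ 0)))
  distribute : ∀ s t u b x d e → s ℤ.* (b ℤ.* x) ℤ.* (d ℤ.- t ℤ.* (u ℤ.* e)) ≡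
    1ℤ ℤ.* (s ℤ.* (b ℤ.* x) ℤ.* d) ℤ.+ ℤ.- (t ℤ.* u) ℤ.* (s ℤ.* b ℤ.* (e ℤ.* x))
  distribute = solve-∀
  step : ∀ k → legendre n k ℤ.* reflectionCoeff n k i ≡
               1ℤ ℤ.* (legendre n k ℤ.* δ k i) ℤ.+ c ℤ.* f k
  -- The symmetry C(n+k,n) = C(n+k,k) brings the Legendre coefficient to the form that
  -- `sum-sign-binomials` sums.
  step k rewrite ℕ.+-identityʳ n | [m+n]Cℤm≡[m+n]Cℤn n k =
    distribute (sign k) (sign n) (sign i) (n Cℤ k) ((n ℕ.+ k) Cℤ k) (δ k i) (k Cℤ i)
  factor : ∀ s t b → 1ℤ ℤ.* (t ℤ.* b) ℤ.+ ℤ.- (s ℤ.* t) ℤ.* (s ℤ.* b) ≡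
                     (1ℤ ℤ.- s ℤ.* s) ℤ.* (t ℤ.* b)
  factor = solve-∀
  vanish : ∀ k → N < k → legendre n k ≡ 0ℤ
  vanish k N<k rewrite k>n⇒nCℤk≡0 (ℕ.≤-<-trans n≤N N<k) = ℤ.*-zeroʳ (sign k)

-- Central binomial coefficients and Legendre coefficients modulo p²

-- Induction on k along `recurrence`. For n < k < p the Legendre coefficient is 0, so there the
-- claim is that p² divides C(2k,k)².
centralBinom²≡legendre*16^ : ∀ n → let p = suc (n ℕ.* 2) in Prime p → ∀ k → k < p →
  + (p ^ 2) ℤ.∣ + (((2 ℕ.* k) C k) ^ 2) ℤ.- legendre n k ℤ.* + (16 ^ k)
centralBinom²≡legendre*16^ n p-prime zero    _     rewrite nCℤ0≡1 n | nCℤ0≡1 (n ℕ.+ 0) =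
  divides 0ℤ refl
centralBinom²≡legendre*16^ n p-prime (suc k) 1+k<p =
  -- The recurrence only gives p² dividing (k+1)² times the difference; since k + 1 < p, the factor
  -- (k+1)² is prime to p² and cancels.
  ℤ.∣ᵤ⇒∣ (ℤ.coprime-divisor (+ (p ^ 2)) (+ (suc k ^ 2)) difference p²⊥[1+k]²
    (ℤ.∣⇒∣ᵤ (subst (+ (p ^ 2) ℤ.∣_) (sym recurrence)
      (ℤ.∣m∣n⇒∣m+n
        (ℤ.∣n⇒∣m*n (+ 4 ℤ.* (K ℤ.* K))
          (centralBinom²≡legendre*16^ n p-prime k (ℕ.<-trans (ℕ.n<1+n k) 1+k<p)))
        (ℤ.∣n⇒∣m*n (+ 4 ℤ.* (legendre n k ℤ.* H)) ℤ.∣-refl)))))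
  where
  open ≡-Reasoning
  p = suc (n ℕ.* 2)
  p²⊥[1+k]² : Coprime (p ^ 2) (suc k ^ 2)
  p²⊥[1+k]² = coprime-^ 2 (Coprimality.sym (coprime-^ 2 (Coprimality.sym
                (prime⇒coprime p-prime 1+k<p))))
  j = + k
  K = 1ℤ ℤ.+ + 2 ℤ.* j
  H = + (16 ^ k)
  x = (2 ℕ.* k) C k
  y = (2 ℕ.* suc k) C suc k
  b = n Cℤ k
  b′ = n Cℤ suc k
  c = (n ℕ.+ k) Cℤ k
  c′ = (n ℕ.+ suc k) Cℤ suc k

  pos-² : ∀ a → + (a ^ 2) ≡ + a ℤ.* + a
  pos-² a = trans (cong (λ z → + (a ℕ.* z)) (ℕ.*-identityʳ a)) (ℤ.pos-* a a)

  y-eq : (1ℤ ℤ.+ j) ℤ.* + y ≡ + 2 ℤ.* K ℤ.* + x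
  y-eq = begin
    + suc k ℤ.* + y                    ≡⟨ ℤ.pos-* (suc k) y ⟨
    + (suc k ℕ.* y)                    ≡⟨ cong +_ (centralBinom-suc k) ⟩
    + (2 ℕ.* (1 ℕ.+ 2 ℕ.* k) ℕ.* x)    ≡⟨ ℤ.pos-* (2 ℕ.* (1 ℕ.+ 2 ℕ.* k)) x ⟩
    + (2 ℕ.* (1 ℕ.+ 2 ℕ.* k)) ℤ.* + x  ≡⟨ cong (ℤ._* + x) (ℤ.pos-* 2 (1 ℕ.+ 2 ℕ.* k)) ⟩
    + 2 ℤ.* + (1 ℕ.+ 2 ℕ.* k) ℤ.* + x  ≡⟨ cong (λ z → + 2 ℤ.* (1ℤ ℤ.+ z) ℤ.* + x) (ℤ.pos-* 2 k) ⟩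
    + 2 ℤ.* K ℤ.* + x                  ∎

  c-eq : (1ℤ ℤ.+ j) ℤ.* c′ ≡ (1ℤ ℤ.+ (+ n ℤ.+ j)) ℤ.* c
  c-eq rewrite ℕ.+-suc n k = absorption (n ℕ.+ k) k

  p-eq : + p ≡ 1ℤ ℤ.+ + n ℤ.* + 2
  p-eq = cong (λ z → 1ℤ ℤ.+ z) (ℤ.pos-* n 2)

  -- Distributes (k+1)² so that each of the binomials `y`, `b`, `c` carries its own k + 1 and its
  -- ratio formula applies.
  clear-denominators : ∀ j y s b c H →
    (1ℤ ℤ.+ j) ℤ.* (1ℤ ℤ.+ j) ℤ.* (y ℤ.* y ℤ.- -1ℤ ℤ.* s ℤ.* (b ℤ.* c) ℤ.* (+ 16 ℤ.* H)) ≡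
    ((1ℤ ℤ.+ j) ℤ.* y) ℤ.* ((1ℤ ℤ.+ j) ℤ.* y)
      ℤ.+ + 16 ℤ.* s ℤ.* H ℤ.* (((1ℤ ℤ.+ j) ℤ.* b) ℤ.* ((1ℤ ℤ.+ j) ℤ.* c))
  clear-denominators = solve-∀

  -- 4 (n - k) (n + k + 1) = (2n + 1)² - (2k + 1)²
  complete-square : ∀ n j x s b c H →
    (+ 2 ℤ.* (1ℤ ℤ.+ + 2 ℤ.* j) ℤ.* x) ℤ.* (+ 2 ℤ.* (1ℤ ℤ.+ + 2 ℤ.* j) ℤ.* x)
      ℤ.+ + 16 ℤ.* s ℤ.* H ℤ.* (((n ℤ.- j) ℤ.* b) ℤ.* ((1ℤ ℤ.+ (n ℤ.+ j)) ℤ.* c)) ≡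
    + 4 ℤ.* ((1ℤ ℤ.+ + 2 ℤ.* j) ℤ.* (1ℤ ℤ.+ + 2 ℤ.* j)) ℤ.* (x ℤ.* x ℤ.- s ℤ.* (b ℤ.* c) ℤ.* H)
      ℤ.+ + 4 ℤ.* (s ℤ.* (b ℤ.* c) ℤ.* H) ℤ.* ((1ℤ ℤ.+ n ℤ.* + 2) ℤ.* (1ℤ ℤ.+ n ℤ.* + 2))
  complete-square = solve-∀

  difference : ℤ
  difference = + (y ^ 2) ℤ.- legendre n (suc k) ℤ.* + (16 ^ suc k)

  -- The two ratios, cleared of (k+1)², are 4(2k+1)² and 4(2k+1)² - 4p². The old difference is thus
  -- multiplied by 4(2k+1)², and the discrepancy is an explicit multiple of p².
  recurrence : + (suc k ^ 2) ℤ.* difference ≡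
    + 4 ℤ.* (K ℤ.* K) ℤ.* (+ (x ^ 2) ℤ.- legendre n k ℤ.* H)
      ℤ.+ + 4 ℤ.* (legendre n k ℤ.* H) ℤ.* + (p ^ 2)
  recurrence = begin
    + (suc k ^ 2) ℤ.* difference
      ≡⟨ cong₂ (λ u v → u ℤ.* (v ℤ.- legendre n (suc k) ℤ.* + (16 ^ suc k))) (pos-² (suc k)) (pos-² y) ⟩
    (1ℤ ℤ.+ j) ℤ.* (1ℤ ℤ.+ j) ℤ.* (+ y ℤ.* + y ℤ.- legendre n (suc k) ℤ.* + (16 ^ suc k))
      ≡⟨ cong (λ v → (1ℤ ℤ.+ j) ℤ.* (1ℤ ℤ.+ j) ℤ.* (+ y ℤ.* + y ℤ.- legendre n (suc k) ℤ.* v))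
              (ℤ.pos-* 16 (16 ^ k)) ⟩
    (1ℤ ℤ.+ j) ℤ.* (1ℤ ℤ.+ j) ℤ.* (+ y ℤ.* + y ℤ.- legendre n (suc k) ℤ.* (+ 16 ℤ.* H))
      ≡⟨ clear-denominators j (+ y) (sign k) b′ c′ H ⟩
    ((1ℤ ℤ.+ j) ℤ.* + y) ℤ.* ((1ℤ ℤ.+ j) ℤ.* + y)
      ℤ.+ + 16 ℤ.* sign k ℤ.* H ℤ.* (((1ℤ ℤ.+ j) ℤ.* b′) ℤ.* ((1ℤ ℤ.+ j) ℤ.* c′))
      ≡⟨ cong₂ (λ u v → u ℤ.* u ℤ.+ + 16 ℤ.* sign k ℤ.* H ℤ.* v) y-eq
               (cong₂ ℤ._*_ ([k+1]*nC[k+1]≡[n-k]*nCk n k) c-eq) ⟩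
    (+ 2 ℤ.* K ℤ.* + x) ℤ.* (+ 2 ℤ.* K ℤ.* + x)
      ℤ.+ + 16 ℤ.* sign k ℤ.* H ℤ.* (((+ n ℤ.- j) ℤ.* b) ℤ.* ((1ℤ ℤ.+ (+ n ℤ.+ j)) ℤ.* c))
      ≡⟨ complete-square (+ n) j (+ x) (sign k) b c H ⟩
    + 4 ℤ.* (K ℤ.* K) ℤ.* (+ x ℤ.* + x ℤ.- legendre n k ℤ.* H)
      ℤ.+ + 4 ℤ.* (legendre n k ℤ.* H) ℤ.* ((1ℤ ℤ.+ + n ℤ.* + 2) ℤ.* (1ℤ ℤ.+ + n ℤ.* + 2))
      ≡⟨ cong₂ (λ u v → + 4 ℤ.* (K ℤ.* K) ℤ.* (u ℤ.- legendre n k ℤ.* H)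
                          ℤ.+ + 4 ℤ.* (legendre n k ℤ.* H) ℤ.* v)
               (sym (pos-² x)) (sym (trans (pos-² p) (cong₂ ℤ._*_ p-eq p-eq))) ⟩
    + 4 ℤ.* (K ℤ.* K) ℤ.* (+ (x ^ 2) ℤ.- legendre n k ℤ.* H)
      ℤ.+ + 4 ℤ.* (legendre n k ℤ.* H) ℤ.* + (p ^ 2)
      ∎

-- Reduction of rational numbers modulo m

infix 4 _↦_[mod_]

-- The graph of the ring homomorphism from the rationals with denominator prime
-- to m onto ℤ/m.

record _↦_[mod_] (q : ℚ) (z : ℤ) (m : ℕ) : Set where
  constructor reduction
  field
    rep       : ℚᵘ
    q≃rep     : toℚᵘ q ≃ rep
    coprime   : Coprime m (ℚᵘ.↧ₙ rep)
    congruent : + m ℤ.∣ ℚᵘ.↥ rep ℤ.- z ℤ.* ℚᵘ.↧ rep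

module _ {m : ℕ} where

  ↦-congʳ : ∀ {q y z} → y ≡ z → q ↦ y [mod m ] → q ↦ z [mod m ]
  ↦-congʳ refl q↦ = q↦

  -- Unnormalised representatives add with the product of the denominators, which stays coprime to
  -- m; no reduction to lowest terms intervenes.
  ↦-+ : ∀ {q r y z} → q ↦ y [mod m ] → r ↦ z [mod m ] → q ℚ.+ r ↦ y ℤ.+ z [mod m ]
  ↦-+ {q} {r} {y} {z} (reduction (mkℚᵘ a d) q≃ m⊥d m∣a) (reduction (mkℚᵘ b e) r≃ m⊥e m∣b) =
    reduction (mkℚᵘ a d ℚᵘ.+ mkℚᵘ b e)
      (ℚᵘ.≃-trans (ℚ.toℚᵘ-homo-+ q r) (ℚᵘ.+-cong q≃ r≃))
      (coprime-* m⊥d m⊥e)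
      (subst (+ m ℤ.∣_) (identity a b y z (+ suc d) (+ suc e))
        (ℤ.∣m∣n⇒∣m+n (ℤ.∣m⇒∣m*n (+ suc e) m∣a) (ℤ.∣m⇒∣m*n (+ suc d) m∣b)))
    where
    identity : ∀ a b y z d e → (a ℤ.- y ℤ.* d) ℤ.* e ℤ.+ (b ℤ.- z ℤ.* e) ℤ.* d ≡
                               a ℤ.* e ℤ.+ b ℤ.* d ℤ.- (y ℤ.+ z) ℤ.* (d ℤ.* e)
    identity = solve-∀

  ↦-* : ∀ {q r y z} → q ↦ y [mod m ] → r ↦ z [mod m ] → q ℚ.* r ↦ y ℤ.* z [mod m ]
  ↦-* {q} {r} {y} {z} (reduction (mkℚᵘ a d) q≃ m⊥d m∣a) (reduction (mkℚᵘ b e) r≃ m⊥e m∣b) =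
    reduction (mkℚᵘ a d ℚᵘ.* mkℚᵘ b e)
      (ℚᵘ.≃-trans (ℚ.toℚᵘ-homo-* q r) (ℚᵘ.*-cong q≃ r≃))
      (coprime-* m⊥d m⊥e)
      (subst (+ m ℤ.∣_) (identity a b y z (+ suc d) (+ suc e))
        (ℤ.∣m∣n⇒∣m+n (ℤ.∣m⇒∣m*n b m∣a) (ℤ.∣n⇒∣m*n (y ℤ.* + suc d) m∣b)))
    where
    identity : ∀ a b y z d e → (a ℤ.- y ℤ.* d) ℤ.* b ℤ.+ (y ℤ.* d) ℤ.* (b ℤ.- z ℤ.* e) ≡
                               a ℤ.* b ℤ.- (y ℤ.* z) ℤ.* (d ℤ.* e)
    identity = solve-∀

  ↦-neg : ∀ {q z} → q ↦ z [mod m ] → ℚ.- q ↦ ℤ.- z [mod m ]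
  ↦-neg {q} {z} (reduction (mkℚᵘ a d) q≃ m⊥d m∣a) =
    reduction (ℚᵘ.- mkℚᵘ a d)
      (ℚᵘ.≃-trans (ℚ.toℚᵘ-homo‿- q) (ℚᵘ.-‿cong q≃))
      m⊥d
      (subst (+ m ℤ.∣_) (identity a z (+ suc d)) (ℤ.∣m⇒∣-m m∣a))
    where
    identity : ∀ a z d → ℤ.- (a ℤ.- z ℤ.* d) ≡ ℤ.- a ℤ.- ℤ.- z ℤ.* d
    identity = solve-∀

  ↦-/ : ∀ a {z} n .{{_ : NonZero n}} → Coprime m n → + m ℤ.∣ a ℤ.- z ℤ.* + n →
        a ℚ./ n ↦ z [mod m ]
  ↦-/ a (suc d) m⊥n m∣a = reduction (mkℚᵘ a d) (ℚ.toℚᵘ-fromℚᵘ (mkℚᵘ a d)) m⊥n m∣a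

  ↦-0 : 0ℚ ↦ 0ℤ [mod m ]
  ↦-0 = ↦-/ 0ℤ 1 (Coprimality.sym (1-coprimeTo m)) (divides 0ℤ refl)

  ↦-1 : 1ℚ ↦ 1ℤ [mod m ]
  ↦-1 = ↦-/ 1ℤ 1 (Coprimality.sym (1-coprimeTo m)) (divides 0ℤ refl)

  -- With b/e in lowest terms and a/d the representative, b d = a e. As m divides a, it divides b d,
  -- and d is coprime to m.
  ↦-0⇒∣ : ∀ {q} → q ↦ 0ℤ [mod m ] → m ℕ.∣ ℤ.∣ ↥ q ∣
  ↦-0⇒∣ {q@(mkℚ b e _)} (reduction (mkℚᵘ a d) (*≡* q≃) m⊥d m∣a) =
    ℤ.coprime-divisor (+ m) (+ suc d) b m⊥d
      (ℤ.∣⇒∣ᵤ (subst (+ m ℤ.∣_) (trans (sym q≃) (ℤ.*-comm b (+ suc d)))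
        (ℤ.∣m⇒∣m*n (+ suc e) (subst (+ m ℤ.∣_) (identity a (+ suc d)) m∣a))))
    where
    identity : ∀ a d → a ℤ.- 0ℤ ℤ.* d ≡ a
    identity = solve-∀

  ↦-sign : ∀ n → (- 1ℚ) ^ℚ n ↦ sign n [mod m ]
  ↦-sign zero    = ↦-1
  ↦-sign (suc n) = ↦-* (↦-neg ↦-1) (↦-sign n)

-- Coefficients of polynomials

coeff-+ₚ : ∀ f g i → coeff (f +ₚ g) i ≡ coeff f i ℚ.+ coeff g i
coeff-+ₚ []      g       i       = sym (ℚ.+-identityˡ (coeff g i))
coeff-+ₚ (a ∷ f) []      i       = sym (ℚ.+-identityʳ (coeff (a ∷ f) i))
coeff-+ₚ (a ∷ f) (b ∷ g) zero    = refl
coeff-+ₚ (a ∷ f) (b ∷ g) (suc i) = coeff-+ₚ f g i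

coeff-· : ∀ c f i → coeff (c · f) i ≡ c ℚ.* coeff f i
coeff-· c []      i       = sym (ℚ.*-zeroʳ c)
coeff-· c (a ∷ f) zero    = refl
coeff-· c (a ∷ f) (suc i) = coeff-· c f i

coeff--ₚ : ∀ f g i → coeff (f -ₚ g) i ≡ coeff f i ℚ.- coeff g i
coeff--ₚ f g i = trans (coeff-+ₚ f _ i) (cong (coeff f i ℚ.+_) (coeff-neg g i))
  where
  coeff-neg : ∀ g i → coeff (map ℚ.-_ g) i ≡ ℚ.- coeff g i
  coeff-neg []      i       = refl
  coeff-neg (b ∷ g) zero    = refl
  coeff-neg (b ∷ g) (suc i) = coeff-neg g i

module _ {m : ℕ} where

  coeff-↦-+ : ∀ f g {y z} i → coeff f i ↦ y [mod m ] → coeff g i ↦ z [mod m ] →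
              coeff (f +ₚ g) i ↦ y ℤ.+ z [mod m ]
  coeff-↦-+ f g i f↦ g↦ = subst (_↦ _ [mod m ]) (sym (coeff-+ₚ f g i)) (↦-+ f↦ g↦)

  coeff-↦-- : ∀ f g {y z} i → coeff f i ↦ y [mod m ] → coeff g i ↦ z [mod m ] →
              coeff (f -ₚ g) i ↦ y ℤ.- z [mod m ]
  coeff-↦-- f g i f↦ g↦ = subst (_↦ _ [mod m ]) (sym (coeff--ₚ f g i)) (↦-+ f↦ (↦-neg g↦))

  coeff-↦-· : ∀ c f {y z} i → c ↦ y [mod m ] → coeff f i ↦ z [mod m ] →
              coeff (c · f) i ↦ y ℤ.* z [mod m ]
  coeff-↦-· c f i c↦ f↦ = subst (_↦ _ [mod m ]) (sym (coeff-· c f i)) (↦-* c↦ f↦)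

  coeff-↦-∑ : ∀ N (t : ℕ → Poly) (z : ℕ → ℤ) i →
              (∀ k → k ≤ N → coeff (t k) i ↦ z k [mod m ]) →
              coeff (∑[k≤ N ] t) i ↦ sum N z [mod m ]
  coeff-↦-∑ zero    t z i t↦ = t↦ 0 ℕ.z≤n
  coeff-↦-∑ (suc N) t z i t↦ = coeff-↦-+ (∑[k≤ N ] t) (t (suc N)) i
    (coeff-↦-∑ N t z i (λ k k≤N → t↦ k (ℕ.m≤n⇒m≤1+n k≤N))) (t↦ (suc N) ℕ.≤-refl)

  -- Both `X` and `1ₚ -ₚ X` evaluate to a list of two coefficients, so multiplication by such a list
  -- is all that their powers require.
  coeff-↦-linear*-zero : ∀ a b f {u y} → a ↦ u [mod m ] → coeff f 0 ↦ y [mod m ] →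
    coeff ((a ∷ b ∷ []) *ₚ f) 0 ↦ u ℤ.* y ℤ.+ 0ℤ [mod m ]
  coeff-↦-linear*-zero a b f a↦ f↦ = coeff-↦-+ (a · f) _ 0 (coeff-↦-· a f 0 a↦ f↦) ↦-0

  coeff-↦-linear*-suc : ∀ a b f i {u v y z} → a ↦ u [mod m ] → b ↦ v [mod m ] →
    coeff f (suc i) ↦ y [mod m ] → coeff f i ↦ z [mod m ] →
    coeff ((a ∷ b ∷ []) *ₚ f) (suc i) ↦ u ℤ.* y ℤ.+ (v ℤ.* z ℤ.+ 0ℤ) [mod m ]
  coeff-↦-linear*-suc a b f i a↦ b↦ f↦y f↦z =
    coeff-↦-+ (a · f) _ (suc i) (coeff-↦-· a f (suc i) a↦ f↦y)
      (coeff-↦-+ (b · f) _ i (coeff-↦-· b f i b↦ f↦z) (trailing i))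
    where
    -- The product with the empty tail after `b` leaves behind the list `0ℚ ∷ []`.
    trailing : ∀ i → coeff (0ℚ ∷ []) i ↦ 0ℤ [mod m ]
    trailing zero    = ↦-0
    trailing (suc i) = ↦-0

  coeff-↦-X^ : ∀ k i → coeff (X ^ₚ k) i ↦ δ k i [mod m ]
  coeff-↦-X^ zero    zero    = ↦-1
  coeff-↦-X^ zero    (suc i) = ↦-0
  coeff-↦-X^ (suc k) zero    = ↦-congʳ (identity (δ k 0))
    (coeff-↦-linear*-zero 0ℚ 1ℚ (X ^ₚ k) ↦-0 (coeff-↦-X^ k 0))
    where
    identity : ∀ y → 0ℤ ℤ.* y ℤ.+ 0ℤ ≡ 0ℤ
    identity = solve-∀
  coeff-↦-X^ (suc k) (suc i) = ↦-congʳ (identity (δ k (suc i)) (δ k i))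
    (coeff-↦-linear*-suc 0ℚ 1ℚ (X ^ₚ k) i ↦-0 ↦-1 (coeff-↦-X^ k (suc i)) (coeff-↦-X^ k i))
    where
    identity : ∀ y z → 0ℤ ℤ.* y ℤ.+ (1ℤ ℤ.* z ℤ.+ 0ℤ) ≡ z
    identity = solve-∀

  -- Multiplying by 1 - x subtracts the next lower coefficient; with alternating signs this is
  -- Pascal's rule.
  coeff-↦-[1-X]^ : ∀ k i → coeff ((1ₚ -ₚ X) ^ₚ k) i ↦ sign i ℤ.* (k Cℤ i) [mod m ]
  coeff-↦-[1-X]^ zero    zero    rewrite nCℤ0≡1 0 = ↦-1
  coeff-↦-[1-X]^ zero    (suc i)
    rewrite k>n⇒nCℤk≡0 {0} {suc i} z<s | ℤ.*-zeroʳ (sign (suc i)) = ↦-0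
  coeff-↦-[1-X]^ (suc k) zero    = ↦-congʳ eq
    (coeff-↦-linear*-zero 1ℚ (- 1ℚ) ((1ₚ -ₚ X) ^ₚ k) ↦-1 (coeff-↦-[1-X]^ k 0))
    where
    eq : 1ℤ ℤ.* (1ℤ ℤ.* (k Cℤ 0)) ℤ.+ 0ℤ ≡ 1ℤ ℤ.* (suc k Cℤ 0)
    eq rewrite nCℤ0≡1 k | nCℤ0≡1 (suc k) = refl
  coeff-↦-[1-X]^ (suc k) (suc i) = ↦-congʳ eq
    (coeff-↦-linear*-suc 1ℚ (- 1ℚ) ((1ₚ -ₚ X) ^ₚ k) i ↦-1 (↦-neg ↦-1)
      (coeff-↦-[1-X]^ k (suc i)) (coeff-↦-[1-X]^ k i))
    where
    identity : ∀ s c d → 1ℤ ℤ.* (-1ℤ ℤ.* s ℤ.* d) ℤ.+ (-1ℤ ℤ.* (s ℤ.* c) ℤ.+ 0ℤ) ≡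
                         -1ℤ ℤ.* s ℤ.* (c ℤ.+ d)
    identity = solve-∀
    eq : 1ℤ ℤ.* (sign (suc i) ℤ.* (k Cℤ suc i)) ℤ.+ (-1ℤ ℤ.* (sign i ℤ.* (k Cℤ i)) ℤ.+ 0ℤ) ≡
         sign (suc i) ℤ.* (suc k Cℤ suc i)
    eq rewrite pascal k i = identity (sign i) (k Cℤ i) (k Cℤ suc i)

-- Congruences for the two truncated sums

reflectionTerm : ℕ → ℕ → Poly
reflectionTerm n k = centralBinom²/16^ k · (X ^ₚ k -ₚ ((- 1ℚ) ^ℚ n) · (1ₚ -ₚ X) ^ₚ k)

module _ (n : ℕ) (p-prime : Prime (suc (n ℕ.* 2))) (2∤p : 2 ∤ suc (n ℕ.* 2)) where

  private
    p = suc (n ℕ.* 2)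

  centralBinom²/16^-↦ : ∀ k → k < p → centralBinom²/16^ k ↦ legendre n k [mod p ^ 2 ]
  centralBinom²/16^-↦ k k<p = ↦-/ (+ (((2 ℕ.* k) C k) ^ 2)) (16 ^ k) {{ℕ.m^n≢0 16 k}}
    -- The base 16 is treated as 2⁴, so that the denominator is prime to p² because p is odd.
    (coprime-^ k (coprime-^ {a = 2} 4 p²⊥2))
    (centralBinom²≡legendre*16^ n p-prime k k<p)
    where
    p²⊥2 : Coprime (p ^ 2) 2
    p²⊥2 = Coprimality.sym (coprime-^ 2 (Coprimality.sym (odd⇒coprime-2 2∤p)))

  -- N < p permits replacing every weight by its Legendre coefficient modulo p², and n ≤ N makes the
  -- resulting integer sum vanish by `legendre-reflection`.
  reflectionSum-↦-0 : ∀ {N} → n ≤ N → N < p → ∀ i →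
    coeff (∑[k≤ N ] (reflectionTerm n)) i ↦ 0ℤ [mod p ^ 2 ]
  reflectionSum-↦-0 {N} n≤N N<p i = ↦-congʳ (legendre-reflection n≤N i)
    (coeff-↦-∑ N (reflectionTerm n) (λ k → legendre n k ℤ.* reflectionCoeff n k i) i λ k k≤N →
      coeff-↦-· (centralBinom²/16^ k) (X ^ₚ k -ₚ ((- 1ℚ) ^ℚ n) · (1ₚ -ₚ X) ^ₚ k) i
        (centralBinom²/16^-↦ k (ℕ.≤-<-trans k≤N N<p))
        (coeff-↦-- (X ^ₚ k) (((- 1ℚ) ^ℚ n) · (1ₚ -ₚ X) ^ₚ k) i (coeff-↦-X^ k i)
          (coeff-↦-· ((- 1ℚ) ^ℚ n) ((1ₚ -ₚ X) ^ₚ k) i (↦-sign n) (coeff-↦-[1-X]^ k i))))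

-- Both sums are 0 modulo p², being the cases N = p - 1 = 2n and N = n, so they are congruent to
-- each other. The equation for p is a separate argument so that matching on it puts 2n + 1 in place
-- of p.
reflectionSum-congruences : ∀ {p} n → p ≡ suc (n ℕ.* 2) → Prime p → 2 ∤ p →
  ((∑[k≤ p ∸ 1 ] (reflectionTerm n)) ≡ (∑[k≤ n ] (reflectionTerm n)) [mod p ^ 2 ])
  × ((∑[k≤ n ] (reflectionTerm n)) ≡ 0ₚ [mod p ^ 2 ])
reflectionSum-congruences {p} n refl p-prime 2∤p =
    (λ i → ↦-0⇒∣ (coeff-↦-- (∑[k≤ p ∸ 1 ] (reflectionTerm n)) (∑[k≤ n ] (reflectionTerm n)) i
             (reflectionSum-↦-0 n p-prime 2∤p (ℕ.m≤m*n n 2) ℕ.≤-refl i)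
             (half i)))
  , (λ i → ↦-0⇒∣ (coeff-↦-- (∑[k≤ n ] (reflectionTerm n)) 0ₚ i (half i) ↦-0))
  where
  half : ∀ i → coeff (∑[k≤ n ] (reflectionTerm n)) i ↦ 0ℤ [mod p ^ 2 ]
  half = reflectionSum-↦-0 n p-prime 2∤p ℕ.≤-refl (s≤s (ℕ.m≤m*n n 2))

theorem2p1 : (p : ℕ) → Prime p → 2 ∤ p →
    let term = λ (k : ℕ) → centralBinom²/16^ k · (X ^ₚ k -ₚ ((- 1ℚ) ^ℚ ((p ∸ 1) / 2)) · (1ₚ -ₚ X) ^ₚ k)
    in ((∑[k≤ p ∸ 1 ] term) ≡ (∑[k≤ (p ∸ 1) / 2 ] term) [mod p ^ 2 ])
    × ((∑[k≤ (p ∸ 1) / 2 ] term) ≡ 0ₚ [mod p ^ 2 ])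
theorem2p1 p p-prime 2∤p =
  reflectionSum-congruences ((p ∸ 1) / 2) (odd⇒≡1+half*2 2∤p) p-prime 2∤p
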